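{- Let $k\ge 2$ and $r\ge 3$ be integers. Suppose there is a constant $c>0$ such that for every sufficiently large integer $n$ there exists an $n$-vertex graph of girth more than $2k$ with $cn^{1+1/k}$ edges. Then there is a constant $c_{k,r}>0$, depending only on $k$ and $r$, such that for all sufficiently large $t$, \[ R(t,\mathcal{B}^r_{k}) \geq c_{k,r}\left(\frac{t}{\log t}\right)^{\frac{k}{k-1}}. \]
   Context: An $r$-graph is a hypergraph all of whose edges have size $r$. An independent set in a hypergraph is a set of vertices containing no edge. For $k\ge 2$, a Berge $k$-cycle is a family of sets $e_1,\dots,e_k$ such that the sets $e_1\cap e_2, e_2\cap e_3,\dots,e_{k-1}\cap e_k, e_k\cap e_1$ have a system of distinct representatives; it is non-trivial if $e_1\cap e_2\cap\dots\cap e_k=\emptyset$. $\mathcal{B}^r_k$ denotes the family of all non-trivial Berge $k$-cycles all of whose sets have size $r$. For a family $\mathcal{F}$ of $r$-graphs, $R(t,\mathcal{F})$ is the minimum $n$ such that every $n$-vertex $r$-graph contains either a member of $\mathcal{F}$ or an independent set of size $t$. Here $\log$ denotes the natural logarithm. -}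

module Defs where

open import Data.Nat using (ℕ; zero; suc; _+_; _*_; _∸_; _^_; _≤_; _<_)
open import Data.Fin using (Fin; toℕ)
import Data.Fin as F
open import Data.Fin.Subset using (Subset; _∈_; _⊆_; ∣_∣)
open import Data.List using (List; length)
open import Data.List.Relation.Unary.All using (All)
open import Data.List.Relation.Unary.Unique.Propositional using (Unique)
import Data.List.Membership.Propositional as LM
open import Data.Product using (Σ; ∃; _×_; _,_)
open import Data.Sum using (_⊎_)
open import Relation.Nullary using (¬_)
open import Relation.Binary.PropositionalEquality using (_≡_)
open import Function.Definitions using (Injective)
open import Data.Nat.Logarithm using (⌊log₂_⌋)

CycSucc : (k : ℕ) → Fin k → Fin k → Set
CycSucc k i j = (suc (toℕ i) ≡ toℕ j) ⊎ ((suc (toℕ i) ≡ k) × (toℕ j ≡ 0))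

record Graph (n : ℕ) : Set where
  field
    edges   : List (Fin n × Fin n)
    ordered : All (λ e → F._<_ (Data.Product.proj₁ e) (Data.Product.proj₂ e)) edges
    unique  : Unique edges

open Graph public

numEdges : ∀ {n} → Graph n → ℕ
numEdges G = length (edges G)

Adj : ∀ {n} → Graph n → Fin n → Fin n → Set
Adj G u v = LM._∈_ (u , v) (edges G) ⊎ LM._∈_ (v , u) (edges G)

HasCycleOfLength : ∀ {n} → Graph n → ℕ → Set
HasCycleOfLength {n} G ℓ =
  (3 ≤ ℓ) × Σ (Fin ℓ → Fin n) λ w →
    Injective _≡_ _≡_ w × (∀ i j → CycSucc ℓ i j → Adj G (w i) (w j))

GirthMoreThan : ∀ {n} → Graph n → ℕ → Set
GirthMoreThan G g = ∀ ℓ → ℓ ≤ g → ¬ HasCycleOfLength G ℓ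

record RGraph (r n : ℕ) : Set₁ where
  field
    Edge    : Subset n → Set
    uniform : ∀ e → Edge e → ∣ e ∣ ≡ r

open RGraph public

IndependentSetOfSize : ∀ {r n} → RGraph r n → ℕ → Set
IndependentSetOfSize {r} {n} H t =
  Σ (Subset n) λ I → (∣ I ∣ ≡ t) × (∀ e → Edge H e → ¬ (e ⊆ I))

ContainsNontrivialBergeCycle : ∀ {r n} → RGraph r n → ℕ → Set
ContainsNontrivialBergeCycle {r} {n} H k =
  Σ (Fin k → Subset n) λ e →
    (∀ i → Edge H (e i)) ×
    Injective _≡_ _≡_ e ×
    (Σ (Fin k → Fin n) λ v →
       Injective _≡_ _≡_ v ×
       (∀ i j → CycSucc k i j → (v i ∈ e i) × (v i ∈ e j))) ×
    (¬ (Σ (Fin n) λ x → ∀ i → x ∈ e i))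

-- m has the Ramsey property for (t, 𝓑^r_k): every m-vertex r-graph contains
-- a member of 𝓑^r_k or an independent set of size t.
-- R(t, 𝓑^r_k) is the least such m.
RamseyProperty : (r k t m : ℕ) → Set₁
RamseyProperty r k t m =
  (H : RGraph r m) → ContainsNontrivialBergeCycle H k ⊎ IndependentSetOfSize H t

{-# OPTIONS --safe #-}
module Submission where

-- Write δ ≈ e(G)/2m for a graph G on m vertices with girth > 2k, and m ≲ δ^k. Cutting the vertices u
-- of G into stars with exactly δ edges each gives m "points", and grouping the edges of these stars by
-- their other end v, in batches of at most s ≈ 8rm/t, gives "blocks" of points. The r-graph H consists
-- of the r-sets that lie inside a block and contain a chosen centre of that block. A Berge k-cycle in H
-- traces a closed walk of length at most 2k in G without backtracking, so it stays in a single block and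
-- all its edges share the centre. On the other hand, a t-set meets the blocks in δt incidences, so for
-- random centres it is independent with probability at most 2^(-δt/2s), which beats the number m^t of
-- t-sets as soon as m log m ≪ δt; the centres are found by the method of conditional expectations.

open import Defs
open import Data.Nat using (ℕ; suc; _+_; _*_; _∸_; _^_; _≤_)
open import Data.Product using (Σ; _×_)
open import Data.Nat.Logarithm using (⌊log₂_⌋)
open import Data.Nat using (zero; _<_; _<?_; _≤ᵇ_; z≤n; s≤s; s≤s⁻¹; NonZero; >-nonZero; >-nonZero⁻¹)
open import Data.Nat.DivMod using (_/_; _mod_; m≡m%n+[m/n]*n; m/n*n≤m; m%n<n; m≥n⇒m/n>0; m<n⇒m%n≡m; n%n≡0)
open import Data.Nat.ListAction using (sum; product)
open import Data.Nat.ListAction.Properties using (sum-++; sum-↭; product≢0)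
open import Data.Nat.Logarithm using (⌊log₂⌋-mono-≤; ⌊log₂[2^n]⌋≡n)
open import Data.Nat.Properties hiding (_≟_)
open import Data.Nat.Tactic.RingSolver using (solve-∀)
open import Data.Bool using (Bool; true; false; not; if_then_else_; _∧_; T; T?)
open import Data.Bool.Properties using (T-≡)
open import Data.Empty using (⊥)
open import Data.Fin using (Fin; toℕ; zero; suc; inject≤)
import Data.Fin.Properties as Fin
open import Data.Fin.Subset using (Subset; inside; outside; ∣_∣; _∈_; _∉_) renaming (⊥ to ∅)
open import Data.Fin.Subset.Properties using (∉⊥; ∣⊥∣≡0; ∣p∣≤n)
open import Data.List
  using (List; []; _∷_; _++_; length; lookup; map; concat; concatMap; filterᵇ; take; tabulate; allFin)
open import Data.List.Properties
  using (length-++; length-map; length-take; length-tabulate; ++-assoc; map-++; map-∘; map-cong;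
         map-tabulate; concatMap-++; take++drop≡id)
import Data.List.Membership.Propositional as L
open import Data.List.Membership.Propositional.Properties
  using (∈-∃++; ∈-lookup; ∈-++⁺ˡ; ∈-++⁺ʳ; ∈-map⁺; ∈-map⁻; ∈-filter⁺; ∈-filter⁻; ∈-concat⁻′; ∈-allFin)
open import Data.List.Relation.Binary.Permutation.Propositional
  using (_↭_; prep; ↭-refl; ↭-reflexive; ↭-sym; ↭-trans; ↭⇒↭ₛ; module PermutationReasoning)
open import Data.List.Relation.Binary.Permutation.Propositional.Properties
  using (++⁺ˡ; shift; shifts; map⁺; ↭-length; ∈-resp-↭)
import Data.List.Relation.Binary.Permutation.Setoid.Properties as PermS
open import Data.List.Relation.Unary.All as All using (All; []; _∷_)
import Data.List.Relation.Unary.All.Properties as AllP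
open import Data.List.Relation.Unary.AllPairs as AllPairs using ([]; _∷_)
import Data.List.Relation.Unary.AllPairs.Properties as AllPairsP
open import Data.List.Relation.Unary.Any using (here; there)
open import Data.List.Relation.Unary.Unique.Propositional using (Unique)
import Data.List.Relation.Unary.Unique.Propositional.Properties as UniqueP
open import Data.Product using (∃; ∃₂; _,_; proj₁; proj₂)
open import Data.Sum using (_⊎_; inj₁; inj₂; [_,_]′; swap; map₁) renaming (map to map-⊎)
open import Data.Unit using (⊤; tt)
open import Data.Vec using ([]; _∷_; here; there; _[_]≔_) renaming (lookup to lookupᵥ)
open import Data.Vec.Properties using ([]=⇒lookup; lookup⇒[]=)
open import Function using (_∘_; Equivalence)
open import Relation.Binary.Definitions using (DecidableEquality)
open import Relation.Binary.PropositionalEquality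
  using (_≡_; _≢_; refl; sym; trans; cong; cong₂; subst; setoid; module ≡-Reasoning)
open import Relation.Nullary using (¬_; yes; no; contradiction)

-- Girth and non-backtracking walks

adj-sym : ∀ {n} (G : Graph n) {u v} → Adj G u v → Adj G v u
adj-sym G = swap

adj-irrefl : ∀ {n} (G : Graph n) {u} → ¬ Adj G u u
adj-irrefl G (inj₁ p) = <-irrefl refl (All.lookup (ordered G) p)
adj-irrefl G (inj₂ p) = <-irrefl refl (All.lookup (ordered G) p)

NonBacktracking : ∀ {n} → Graph n → List (Fin n) → Set
NonBacktracking G []              = ⊤
NonBacktracking G (a ∷ [])        = ⊤
NonBacktracking G (a ∷ b ∷ [])    = Adj G a b
NonBacktracking G (a ∷ b ∷ c ∷ l) = Adj G a b × a ≢ c × NonBacktracking G (b ∷ c ∷ l)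

module _ {n} (G : Graph n) where

  nb-head : ∀ a b l → NonBacktracking G (a ∷ b ∷ l) → Adj G a b
  nb-head a b []      p = p
  nb-head a b (c ∷ l) p = proj₁ p

  nb-tail : ∀ a l → NonBacktracking G (a ∷ l) → NonBacktracking G l
  nb-tail a []          p = tt
  nb-tail a (b ∷ [])    p = tt
  nb-tail a (b ∷ c ∷ l) p = proj₂ (proj₂ p)

  consecutive-adj : ∀ l zs → NonBacktracking G (l ++ zs) →
    ∀ i j → suc (toℕ i) ≡ toℕ j → Adj G (lookup l i) (lookup l j)
  consecutive-adj (a ∷ b ∷ l) zs p zero    (suc zero) eq = nb-head a b (l ++ zs) p
  consecutive-adj (a ∷ l)     zs p (suc i) (suc j)    eq =
    consecutive-adj l zs (nb-tail a (l ++ zs) p) i j (suc-injective eq)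
  consecutive-adj (a ∷ b ∷ l) zs p zero    zero          ()
  consecutive-adj (a ∷ b ∷ l) zs p zero    (suc (suc j)) ()

  last-adj : ∀ l a zs → NonBacktracking G (l ++ a ∷ zs) →
    ∀ i → suc (toℕ i) ≡ length l → Adj G (lookup l i) a
  last-adj (b ∷ [])    a zs p zero    eq = nb-head b a zs p
  last-adj (b ∷ c ∷ l) a zs p (suc i) eq =
    last-adj (c ∷ l) a zs (nb-tail b (c ∷ l ++ a ∷ zs) p) i (suc-injective eq)

unique-++ˡ : ∀ {A : Set} (xs : List A) {ys} → Unique (xs ++ ys) → Unique xs
unique-++ˡ []       u       = []
unique-++ˡ (x ∷ xs) (p ∷ u) =
  All.tabulate (λ q → All.lookup p (∈-++⁺ˡ q)) ∷ unique-++ˡ xs u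

unique-++-disjoint : ∀ {A : Set} {x : A} (xs : List A) {ys} →
  Unique (xs ++ ys) → x L.∈ xs → x L.∉ ys
unique-++-disjoint (x ∷ xs) (p ∷ u) (here refl) q = All.lookup p (∈-++⁺ʳ xs q) refl
unique-++-disjoint (x ∷ xs) (p ∷ u) (there r) q = unique-++-disjoint xs u r q

unique-lookup-injective : ∀ {A : Set} (l : List A) → Unique l →
  ∀ {i j} → lookup l i ≡ lookup l j → i ≡ j
unique-lookup-injective (x ∷ l) (p ∷ u) {zero}  {zero}  eq = refl
unique-lookup-injective (x ∷ l) (p ∷ u) {zero}  {suc j} eq =
  contradiction eq (All.lookup p (∈-lookup j))
unique-lookup-injective (x ∷ l) (p ∷ u) {suc i} {zero}  eq =
  contradiction (sym eq) (All.lookup p (∈-lookup i))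
unique-lookup-injective (x ∷ l) (p ∷ u) {suc i} {suc j} eq =
  cong suc (unique-lookup-injective l u eq)

module _ {n} (G : Graph n) {g} (girth : GirthMoreThan G g) where

  -- At the first return to `a`, the vertices `a ∷ ys` are distinct because `l` is. An empty `ys`
  -- would give a loop, a single vertex a backtracking step, and a longer `ys` a cycle of length at
  -- most `g`.
  head-∉ : ∀ a l → suc (length l) ≤ suc g → NonBacktracking G (a ∷ l) → Unique l →
    ¬ (∃₂ λ ys zs → l ≡ ys ++ a ∷ zs)
  head-∉ a l len p ul ([] , zs , refl) = adj-irrefl G (nb-head G a a zs p)
  head-∉ a l len p ul (y ∷ [] , zs , refl) = proj₁ (proj₂ p) refl
  head-∉ a l len p ul (ys@(y₁ ∷ y₂ ∷ ys′) , zs , refl) =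
    girth (length (a ∷ ys)) short
      (s≤s (s≤s (s≤s z≤n)) , lookup (a ∷ ys) , unique-lookup-injective (a ∷ ys) cycle-unique , adjacent)
    where
    short : length (a ∷ ys) ≤ g
    short = s≤s⁻¹ (≤-trans (≤-trans (≤-reflexive (cong suc (+-comm 1 (length ys))))
      (s≤s (+-monoʳ-≤ (length ys) (s≤s z≤n))))
      (subst (_≤ suc g) (cong suc (length-++ ys)) len))

    cycle-unique : Unique (a ∷ ys)
    cycle-unique =
      All.tabulate (λ { q refl → unique-++-disjoint ys ul q (here refl) }) ∷ unique-++ˡ ys ul

    adjacent : ∀ i j → CycSucc (length (a ∷ ys)) i j → Adj G (lookup (a ∷ ys) i) (lookup (a ∷ ys) j)
    adjacent i j       (inj₁ eq)          = consecutive-adj G (a ∷ ys) (a ∷ zs) p i j eq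
    adjacent i zero    (inj₂ (eq , refl)) = last-adj G (a ∷ ys) a zs p i eq

  -- The bound `suc g` counts vertices, so walks with up to `g` edges are covered.
  nonBacktracking⇒unique : ∀ l → length l ≤ suc g → NonBacktracking G l → Unique l
  nonBacktracking⇒unique []      len p = []
  nonBacktracking⇒unique (a ∷ l) len p =
    All.tabulate (λ { q refl → head-∉ a l len p ul (∈-∃++ q) }) ∷ ul
    where
    ul : Unique l
    ul = nonBacktracking⇒unique l (≤-trans (n≤1+n _) len) (nb-tail G a l p)

-- A cyclic sequence of blocks, successive ones sharing a point, traces a walk in G that visits the
-- line of each block and the vertex π x of each transition point x at which the line changes. The
-- vertices are listed with the most recent one first.
module BergeCycles {n g} (G : Graph n) (girth : GirthMoreThan G g)
  {Point Block : Set} (_∈ᵇ_ : Point → Block → Set)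
  (π : Point → Fin n) (line : Block → Fin n)
  (incident : ∀ {x b} → x ∈ᵇ b → Adj G (π x) (line b))
  (π-injective : ∀ {x y b} → x ∈ᵇ b → y ∈ᵇ b → π x ≡ π y → x ≡ y)
  (line-injective : ∀ {x b c} → x ∈ᵇ b → x ∈ᵇ c → line b ≡ line c → b ≡ c)
  (k : ℕ) (2k≤g : 2 * k ≤ g) (P : ℕ → Block) (x : ℕ → Point)
  (x∈P : ∀ j → j < k → x j ∈ᵇ P j) (x∈P⁺ : ∀ j → j < k → x j ∈ᵇ P (suc j))
  (x-injective : ∀ i j → i < j → j < k → x i ≢ x j)
  where

  -- Remembers the point through which the walk reached the current line. The next transition point
  -- is a different point of the same block, so its vertex under `π` differs as well and the walk
  -- does not backtrack at the line.
  EntersFrom : ℕ → List (Fin n) → Set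
  EntersFrom j []      = ⊤
  EntersFrom j (a ∷ _) = ∃ λ i → i < j × a ≡ π (x i) × x i ∈ᵇ P j

  -- Each change of line adds two vertices, whence `short`. Either the line has never changed and
  -- all blocks so far coincide, or the initial line is already in `history`, so that coming back to
  -- it repeats a vertex.
  record Trace (j : ℕ) : Set where
    field
      history : List (Fin n)
      walk    : NonBacktracking G (line (P j) ∷ history)
      short   : length history ≤ 2 * j
      enters  : EntersFrom j history
      origin  : (history ≡ [] × ∀ i → i ≤ j → P i ≡ P 0) ⊎ line (P 0) L.∈ history

  open Trace

  trace : ∀ j → j ≤ k → Trace j
  trace zero j≤k = record
    { history = [] ; walk = tt ; short = z≤n ; enters = tt
    ; origin = inj₁ (refl , λ { zero z≤n → refl }) }
  trace (suc j) j<k with trace j (<⇒≤ j<k) | line (P (suc j)) Fin.≟ line (P j)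
  ... | record { history = h ; walk = w ; short = s ; enters = e ; origin = o } | yes eq =
    record
      { history = h
      ; walk = subst (λ b → NonBacktracking G (line b ∷ h)) (sym same) w
      ; short = ≤-trans s (*-monoʳ-≤ 2 (n≤1+n j))
      ; enters = later h e
      ; origin = map₁ (λ (p , q) → p , λ i i≤ → extend q i (m≤n⇒m<n∨m≡n i≤)) o
      }
    where
    same : P (suc j) ≡ P j
    -- Both blocks contain `x j`, so equal lines force equal blocks.
    same = line-injective (x∈P⁺ j j<k) (x∈P j j<k) eq

    later : ∀ h → EntersFrom j h → EntersFrom (suc j) h
    later []      _                   = tt
    later (a ∷ _) (i , i<j , eq , i∈) = i , m<n⇒m<1+n i<j , eq , subst (x i ∈ᵇ_) (sym same) i∈

    extend : (∀ i → i ≤ j → P i ≡ P 0) → ∀ i → i < suc j ⊎ i ≡ suc j → P i ≡ P 0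
    extend q i (inj₁ i<)   = q i (s≤s⁻¹ i<)
    extend q _ (inj₂ refl) = trans same (q j ≤-refl)
  ... | record { history = h ; walk = w ; short = s ; enters = e ; origin = o } | no neq =
    record
      { history = π (x j) ∷ line (P j) ∷ h
      -- Backtracking is excluded at `π (x j)` by `neq` and at `line (P j)` by `walk′`.
      ; walk = adj-sym G (incident (x∈P⁺ j j<k)) , neq , walk′ h w e
      ; short = ≤-trans (s≤s (s≤s s)) (≤-reflexive (sym (*-suc 2 j)))
      ; enters = j , ≤-refl , refl , x∈P⁺ j j<k
      ; origin = inj₂ (there (origin′ o))
      }
    where
    walk′ : ∀ h → NonBacktracking G (line (P j) ∷ h) → EntersFrom j h →
      NonBacktracking G (π (x j) ∷ line (P j) ∷ h)
    walk′ []      w _ = incident (x∈P j j<k)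
    walk′ (a ∷ h) w (i , i<j , refl , i∈) =
      incident (x∈P j j<k) ,
      (λ eq → x-injective i j i<j j<k (π-injective i∈ (x∈P j j<k) (sym eq))) , w

    origin′ : (h ≡ [] × ∀ i → i ≤ j → P i ≡ P 0) ⊎ line (P 0) L.∈ h → line (P 0) L.∈ (line (P j) ∷ h)
    origin′ (inj₁ (_ , q)) = here (cong line (sym (q j ≤-refl)))
    origin′ (inj₂ q)       = there q

  -- If the line had changed, `line (P 0)` would occur in `history` and, since the sequence closes
  -- up, also at the head of the walk. But the walk has at most `2 * k + 1` vertices, which the
  -- girth makes distinct.
  blocks-equal : P k ≡ P 0 → ∀ i → i ≤ k → P i ≡ P 0
  blocks-equal closed with trace k ≤-refl
  ... | record { origin = inj₁ (_ , q) } = q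
  ... | record { history = h ; walk = w ; short = s ; origin = inj₂ q }
    with nonBacktracking⇒unique G girth (line (P k) ∷ h) (s≤s (≤-trans s 2k≤g)) w
  ... | p ∷ _ = contradiction (cong line closed) (All.lookup p q)

-- Splitting a list of pairs by key into batches

sumOver : ∀ {A : Set} → (A → ℕ) → List A → ℕ
sumOver f l = sum (map f l)

sumOver-++ : ∀ {A : Set} (f : A → ℕ) xs ys → sumOver f (xs ++ ys) ≡ sumOver f xs + sumOver f ys
sumOver-++ f xs ys = trans (cong sum (map-++ f xs ys)) (sum-++ (map f xs) (map f ys))

sumOver-↭ : ∀ {A : Set} (f : A → ℕ) {xs ys} → xs ↭ ys → sumOver f xs ≡ sumOver f ys
sumOver-↭ f p = sum-↭ (map⁺ f p)

sumOver-mono : ∀ {A : Set} {f g : A → ℕ} xs → (∀ x → f x ≤ g x) → sumOver f xs ≤ sumOver g xs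
sumOver-mono []       h = z≤n
sumOver-mono (x ∷ xs) h = +-mono-≤ (h x) (sumOver-mono xs h)

sumOver-+ : ∀ {A : Set} (f g : A → ℕ) xs → sumOver (λ x → f x + g x) xs ≡ sumOver f xs + sumOver g xs
sumOver-+ f g []       = refl
sumOver-+ f g (x ∷ xs) rewrite sumOver-+ f g xs = interchange (f x) (g x) (sumOver f xs) (sumOver g xs)
  where
  interchange : ∀ a b c d → a + b + (c + d) ≡ a + c + (b + d)
  interchange = solve-∀

sumOver-const : ∀ {A : Set} c (xs : List A) → sumOver (λ _ → c) xs ≡ length xs * c
sumOver-const c []       = refl
sumOver-const c (x ∷ xs) = cong (c +_) (sumOver-const c xs)

sumOver-*ˡ : ∀ {A : Set} c (f : A → ℕ) xs → sumOver (λ x → c * f x) xs ≡ c * sumOver f xs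
sumOver-*ˡ c f []       = sym (*-zeroʳ c)
sumOver-*ˡ c f (x ∷ xs) rewrite sumOver-*ˡ c f xs = sym (*-distribˡ-+ c (f x) (sumOver f xs))

sumOver-≤ : ∀ {A : Set} {f : A → ℕ} {c} {xs} → All (λ x → f x ≤ c) xs → sumOver f xs ≤ length xs * c
sumOver-≤ []       = z≤n
sumOver-≤ (p ∷ ps) = +-mono-≤ p (sumOver-≤ ps)

sumOver-≡ : ∀ {A : Set} {f : A → ℕ} {c} {xs} → All (λ x → f x ≡ c) xs → sumOver f xs ≡ length xs * c
sumOver-≡ []       = refl
sumOver-≡ (p ∷ ps) = cong₂ _+_ p (sumOver-≡ ps)

unique-++ʳ : ∀ {A : Set} (xs : List A) {ys} → Unique (xs ++ ys) → Unique ys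
unique-++ʳ []       u       = u
unique-++ʳ (x ∷ xs) (_ ∷ u) = unique-++ʳ xs u

module _ {K V : Set} where

  expand : K × List V → List (K × V)
  expand (k , vs) = map (k ,_) vs

  ∈-expand : ∀ {k v} {vs : List V} → v L.∈ vs → (k , v) L.∈ expand (k , vs)
  ∈-expand = ∈-map⁺ _

  expand-unique : ∀ Bs → Unique (concatMap expand Bs) → ∀ i → Unique (proj₂ (lookup Bs i))
  expand-unique (b ∷ Bs) u zero    = UniqueP.map⁻ (unique-++ˡ (expand b) u)
  expand-unique (b ∷ Bs) u (suc i) = expand-unique Bs (unique-++ʳ (expand b) u) i

  ∈-block : ∀ Bs i {v} → v L.∈ proj₂ (lookup Bs i) → (proj₁ (lookup Bs i) , v) L.∈ concatMap expand Bs
  ∈-block (b ∷ Bs) zero    p = ∈-++⁺ˡ (∈-expand p)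
  ∈-block (b ∷ Bs) (suc i) p = ∈-++⁺ʳ (expand b) (∈-block Bs i p)

  -- A value shared by two different blocks with the same key would make one pair occur twice in the
  -- expanded list. This serves both for stars at a vertex and for blocks on a line.
  block-unique : ∀ Bs → Unique (concatMap expand Bs) → ∀ i j {v} →
    proj₁ (lookup Bs i) ≡ proj₁ (lookup Bs j) →
    v L.∈ proj₂ (lookup Bs i) → v L.∈ proj₂ (lookup Bs j) → i ≡ j
  block-unique (b ∷ Bs) u zero    zero    eq p q = refl
  block-unique (b ∷ Bs) u zero    (suc j) eq p q =
    contradiction (subst (λ k → (k , _) L.∈ _) (sym eq) (∈-block Bs j q))
      (unique-++-disjoint (expand b) u (∈-expand p))
  block-unique (b ∷ Bs) u (suc i) zero    eq p q =
    contradiction (subst (λ k → (k , _) L.∈ _) eq (∈-block Bs i p))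
      (unique-++-disjoint (expand b) u (∈-expand q))
  block-unique (b ∷ Bs) u (suc i) (suc j) eq p q =
    cong suc (block-unique Bs (unique-++ʳ (expand b) u) i j eq p q)

  sumOver-blocks : ∀ (f : V → ℕ) Bs →
    sumOver (λ b → sumOver f (proj₂ b)) Bs ≡ sumOver (λ e → f (proj₂ e)) (concatMap expand Bs)
  sumOver-blocks f []       = refl
  sumOver-blocks f (b ∷ Bs) = trans
    (cong₂ _+_ (cong sum (map-∘ (proj₂ b))) (sumOver-blocks f Bs))
    (sym (sumOver-++ (λ e → f (proj₂ e)) (expand b) (concatMap expand Bs)))

  length-concatMap-expand : ∀ Bs → length (concatMap expand Bs) ≡ sumOver (λ b → length (proj₂ b)) Bs
  length-concatMap-expand []       = refl
  length-concatMap-expand (b ∷ Bs) = trans (length-++ (expand b))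
    (cong₂ _+_ (length-map _ (proj₂ b)) (length-concatMap-expand Bs))

  extract : (_≟_ : DecidableEquality K) → ∀ k ks (E : List (K × V)) → All (λ e → proj₁ e L.∈ k ∷ ks) E →
    ∃₂ λ vs E′ → (expand (k , vs) ++ E′ ↭ E) × All (λ e → proj₁ e L.∈ ks) E′
  extract _≟_ k ks [] [] = [] , [] , ↭-refl , []
  extract _≟_ k ks (e@(k′ , v) ∷ E) (p ∷ ps) with extract _≟_ k ks E ps | k′ ≟ k | p
  ... | vs , E′ , perm , q | yes refl | _        = v ∷ vs , E′ , prep e perm , q
  ... | vs , E′ , perm , q | no ≢k    | here eq  = contradiction eq ≢k
  ... | vs , E′ , perm , q | no _     | there p′ =
    vs , e ∷ E′ , ↭-trans (shift e (expand (k , vs)) E′) (prep e perm) , p′ ∷ q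

  -- Batches have size `suc s`. The incomplete one is kept at the front and turned into a full batch
  -- as soon as it has `s` elements and receives another.
  chunk : ∀ s (vs : List V) → ∃₂ λ rest cs →
    rest ++ concat cs ≡ vs × length rest ≤ s × All (λ c → length c ≡ suc s) cs
  chunk s []       = [] , [] , refl , z≤n , []
  chunk s (v ∷ vs) with chunk s vs
  ... | rest , cs , eq , short , full with m≤n⇒m<n∨m≡n short
  ...   | inj₁ short′ = v ∷ rest , cs , cong (v ∷_) eq , short′ , full
  ...   | inj₂ full′  = [] , (v ∷ rest) ∷ cs , cong (v ∷_) eq , z≤n , cong suc full′ ∷ full

  -- Here `n` is the number of keys: each key leaves at most one incomplete batch, which gives
  -- `few`. Grouping reorders the pairs, so `splits` is a permutation.
  record Splitting (s n : ℕ) (E : List (K × V)) : Set where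
    field
      rests fulls : List (K × List V)
      splits      : concatMap expand rests ++ concatMap expand fulls ↭ E
      short       : All (λ b → length (proj₂ b) ≤ s) rests
      nonempty    : All (λ b → 1 ≤ length (proj₂ b)) rests
      few         : length rests ≤ n
      full        : All (λ b → length (proj₂ b) ≡ s) fulls

  expand-chunks : ∀ k (cs : List (List V)) → concatMap expand (map (k ,_) cs) ≡ expand (k , concat cs)
  expand-chunks k []       = refl
  expand-chunks k (c ∷ cs) = trans (cong (expand (k , c) ++_) (expand-chunks k cs)) (sym (map-++ _ c (concat cs)))

  shuffle : ∀ {A : Set} (a b c d : List A) → (a ++ b) ++ (c ++ d) ↭ (a ++ c) ++ (b ++ d)
  shuffle a b c d = begin
    (a ++ b) ++ (c ++ d) ≡⟨ ++-assoc a b (c ++ d) ⟩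
    a ++ (b ++ (c ++ d)) ↭⟨ ++⁺ˡ a (shifts b c) ⟩
    a ++ (c ++ (b ++ d)) ≡⟨ ++-assoc a c (b ++ d) ⟨
    (a ++ c) ++ (b ++ d) ∎
    where open PermutationReasoning

  split : DecidableEquality K → ∀ s ks (E : List (K × V)) → All (λ e → proj₁ e L.∈ ks) E →
    Splitting (suc s) (length ks) E
  split _≟_ s [] [] [] = record
    { rests = [] ; fulls = [] ; splits = ↭-refl ; short = [] ; nonempty = [] ; few = z≤n ; full = [] }
  split _≟_ s (k ∷ ks) E ps with extract _≟_ k ks E ps
  ... | vs , E′ , perm , ps′ with chunk s vs | split _≟_ s ks E′ ps′
  ...   | rest , cs , refl , rest≤ , cs-full | S = go rest refl
    where
    open Splitting S
    fulls′ : List (K × List V)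
    fulls′ = map (k ,_) cs ++ fulls

    full′ : All (λ b → length (proj₂ b) ≡ suc s) fulls′
    full′ = AllP.++⁺ (AllP.map⁺ cs-full) full

    splits′ : (expand (k , rest) ++ concatMap expand rests) ++ concatMap expand fulls′ ↭ E
    splits′ = begin
      (expand (k , rest) ++ concatMap expand rests) ++ concatMap expand fulls′
        ≡⟨ cong ((expand (k , rest) ++ concatMap expand rests) ++_)
             (trans (concatMap-++ expand (map (k ,_) cs) fulls)
               (cong (_++ concatMap expand fulls) (expand-chunks k cs))) ⟩
      (expand (k , rest) ++ concatMap expand rests) ++ (expand (k , concat cs) ++ concatMap expand fulls)
        ↭⟨ shuffle (expand (k , rest)) _ (expand (k , concat cs)) _ ⟩
      (expand (k , rest) ++ expand (k , concat cs)) ++ (concatMap expand rests ++ concatMap expand fulls)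
        ≡⟨ cong (_++ (concatMap expand rests ++ concatMap expand fulls)) (map-++ _ rest (concat cs)) ⟨
      expand (k , rest ++ concat cs) ++ (concatMap expand rests ++ concatMap expand fulls)
        ↭⟨ ++⁺ˡ _ splits ⟩
      expand (k , rest ++ concat cs) ++ E′ ↭⟨ perm ⟩
      E ∎
      where open PermutationReasoning

    -- An empty remainder is dropped, to keep `nonempty`.
    go : ∀ r → r ≡ rest → Splitting (suc s) (suc (length ks)) E
    go []      refl = record
      { rests = rests ; fulls = fulls′ ; splits = splits′ ; short = short ; nonempty = nonempty
      ; few = m≤n⇒m≤1+n few ; full = full′ }
    go (_ ∷ _) refl = record
      { rests = (k , rest) ∷ rests ; fulls = fulls′ ; splits = splits′ ; short = m≤n⇒m≤1+n rest≤ ∷ short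
      ; nonempty = s≤s z≤n ∷ nonempty ; few = s≤s few ; full = full′ }

  module SplittingProperties {s n E} (S : Splitting (suc s) n E) where
    open Splitting S

    blocks : List (K × List V)
    blocks = rests ++ fulls

    blocks-↭ : concatMap expand blocks ↭ E
    blocks-↭ = ↭-trans (↭-reflexive (concatMap-++ expand rests fulls)) splits

    private
      length-E : length E ≡ sumOver (λ b → length (proj₂ b)) rests + sumOver (λ b → length (proj₂ b)) fulls
      length-E = trans (sym (↭-length splits)) (trans (length-++ (concatMap expand rests))
        (cong₂ _+_ (length-concatMap-expand rests) (length-concatMap-expand fulls)))

    length-fulls : length fulls * suc s ≤ length E
    length-fulls = begin
      length fulls * suc s                 ≡⟨ sumOver-≡ full ⟨
      sumOver (λ b → length (proj₂ b)) fulls ≤⟨ m≤n+m _ _ ⟩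
      _                                    ≡⟨ length-E ⟨
      length E                             ∎
      where open ≤-Reasoning

    -- Read as a lower bound on the number of full batches, this provides the points of the
    -- construction.
    length-E≤ : length E ≤ n * suc s + length fulls * suc s
    length-E≤ = ≤-trans (≤-reflexive length-E)
      (+-mono-≤ (≤-trans (sumOver-≤ short) (*-monoˡ-≤ (suc s) few)) (≤-reflexive (sumOver-≡ full)))

    length-blocks : length blocks * suc s ≤ n * suc s + length E
    length-blocks = begin
      length blocks * suc s                        ≡⟨ cong (_* suc s) (length-++ rests) ⟩
      (length rests + length fulls) * suc s        ≡⟨ *-distribʳ-+ (suc s) (length rests) _ ⟩
      length rests * suc s + length fulls * suc s  ≤⟨ +-mono-≤ (*-monoˡ-≤ (suc s) few) length-fulls ⟩
      n * suc s + length E                         ∎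
      where open ≤-Reasoning

    blocks-short : All (λ b → length (proj₂ b) ≤ suc s) blocks
    blocks-short = AllP.++⁺ short (All.map ≤-reflexive full)

    blocks-nonempty : All (λ b → 1 ≤ length (proj₂ b)) blocks
    blocks-nonempty = AllP.++⁺ nonempty (All.map (λ eq → ≤-trans (s≤s z≤n) (≤-reflexive (sym eq))) full)

    blocks-sum : ∀ (f : V → ℕ) → sumOver (λ b → sumOver f (proj₂ b)) blocks ≡ sumOver (λ e → f (proj₂ e)) E
    blocks-sum f = trans (sumOver-blocks f blocks) (sumOver-↭ _ blocks-↭)

Unique-resp-↭ : ∀ {A : Set} {xs ys : List A} → xs ↭ ys → Unique xs → Unique ys
Unique-resp-↭ p = PermS.Unique-resp-↭ (setoid _) (↭⇒↭ₛ p)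

-- Choosing the centres

subsetsOfSize : ∀ n → ℕ → List (Subset n)
subsetsOfSize zero    zero    = [] ∷ []
subsetsOfSize zero    (suc t) = []
subsetsOfSize (suc n) zero    = map (outside ∷_) (subsetsOfSize n zero)
subsetsOfSize (suc n) (suc t) =
  map (inside ∷_) (subsetsOfSize n t) ++ map (outside ∷_) (subsetsOfSize n (suc t))

∈-subsetsOfSize : ∀ {n} (I : Subset n) → I L.∈ subsetsOfSize n ∣ I ∣
∈-subsetsOfSize []            = here refl
∈-subsetsOfSize (inside ∷ I)  = ∈-++⁺ˡ (∈-map⁺ _ (∈-subsetsOfSize I))
∈-subsetsOfSize (outside ∷ I) with ∣ I ∣ | ∈-subsetsOfSize I
... | zero  | p = ∈-map⁺ _ p
... | suc t | p = ∈-++⁺ʳ (map (inside ∷_) (subsetsOfSize _ t)) (∈-map⁺ _ p)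

subsetsOfSize-size : ∀ n t → All (λ I → ∣ I ∣ ≡ t) (subsetsOfSize n t)
subsetsOfSize-size zero    zero    = refl ∷ []
subsetsOfSize-size zero    (suc t) = []
subsetsOfSize-size (suc n) zero    = AllP.map⁺ (subsetsOfSize-size n zero)
subsetsOfSize-size (suc n) (suc t) =
  AllP.++⁺ (AllP.map⁺ (All.map (cong suc) (subsetsOfSize-size n t))) (AllP.map⁺ (subsetsOfSize-size n (suc t)))

-- This crude bound on the binomial coefficient is enough: only its logarithm, at most `t` times
-- that of `n`, enters the union bound.
length-subsetsOfSize : ∀ n t → length (subsetsOfSize n t) ≤ n ^ t
length-subsetsOfSize zero    zero    = s≤s z≤n
length-subsetsOfSize zero    (suc t) = z≤n
length-subsetsOfSize (suc n) zero    =
  ≤-trans (≤-reflexive (length-map _ (subsetsOfSize n zero))) (length-subsetsOfSize n zero)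
length-subsetsOfSize (suc n) (suc t) = begin
  length (map (inside ∷_) (subsetsOfSize n t) ++ map (outside ∷_) (subsetsOfSize n (suc t)))
    ≡⟨ length-++ (map (inside ∷_) (subsetsOfSize n t)) ⟩
  length (map (inside ∷_) (subsetsOfSize n t)) + length (map (outside ∷_) (subsetsOfSize n (suc t)))
    ≡⟨ cong₂ _+_ (length-map _ (subsetsOfSize n t)) (length-map _ (subsetsOfSize n (suc t))) ⟩
  length (subsetsOfSize n t) + length (subsetsOfSize n (suc t))
    ≤⟨ +-mono-≤ (length-subsetsOfSize n t) (length-subsetsOfSize n (suc t)) ⟩
  n ^ t + n * n ^ t ≤⟨ *-monoʳ-≤ (suc n) (^-monoˡ-≤ t (n≤1+n n)) ⟩
  suc n * suc n ^ t ∎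
  where open ≤-Reasoning

fromList : ∀ {n} → List (Fin n) → Subset n
fromList []      = ∅
fromList (x ∷ l) = fromList l [ x ]≔ inside

[]≔-∈ : ∀ {n} (p : Subset n) x → x ∈ (p [ x ]≔ inside)
[]≔-∈ (b ∷ p) zero    = here
[]≔-∈ (b ∷ p) (suc x) = there ([]≔-∈ p x)

∈-[]≔⁻ : ∀ {n} (p : Subset n) x {y} → y ∈ (p [ x ]≔ inside) → y ≡ x ⊎ y ∈ p
∈-[]≔⁻ (b ∷ p) zero    here      = inj₁ refl
∈-[]≔⁻ (b ∷ p) zero    (there q) = inj₂ (there q)
∈-[]≔⁻ (b ∷ p) (suc x) here      = inj₂ here
∈-[]≔⁻ (b ∷ p) (suc x) (there q) = map-⊎ (cong suc) there (∈-[]≔⁻ p x q)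

∣[]≔∣ : ∀ {n} (p : Subset n) x → x ∉ p → ∣ p [ x ]≔ inside ∣ ≡ suc ∣ p ∣
∣[]≔∣ (inside  ∷ p) zero    x∉ = contradiction here x∉
∣[]≔∣ (outside ∷ p) zero    x∉ = refl
∣[]≔∣ (inside  ∷ p) (suc x) x∉ = cong suc (∣[]≔∣ p x (λ q → x∉ (there q)))
∣[]≔∣ (outside ∷ p) (suc x) x∉ = ∣[]≔∣ p x (λ q → x∉ (there q))

∈-fromList⁻ : ∀ {n} (l : List (Fin n)) {y} → y ∈ fromList l → y L.∈ l
∈-fromList⁻ []      p = contradiction p ∉⊥
∈-fromList⁻ (x ∷ l) p with ∈-[]≔⁻ (fromList l) x p
... | inj₁ refl = here refl
... | inj₂ q    = there (∈-fromList⁻ l q)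

∣fromList∣ : ∀ {n} (l : List (Fin n)) → Unique l → ∣ fromList l ∣ ≡ length l
∣fromList∣ {n} []  u       = ∣⊥∣≡0 n
∣fromList∣ (x ∷ l) (p ∷ u) =
  trans (∣[]≔∣ (fromList l) x (λ q → All.lookup p (∈-fromList⁻ l q) refl)) (cong suc (∣fromList∣ l u))

-- The method of conditional expectations

⟦_⟧ : Bool → ℕ
⟦ true ⟧  = 1
⟦ false ⟧ = 0

-- Weighted form of the method of conditional expectations: `surv b I` counts the choices at b that
-- do not kill I, so the weights are proportional to the survival probabilities of the sets I.
module Greedy {A C Block : Set} (choices : Block → List C) (kill : Block → C → A → Bool) where

  surv : Block → A → ℕ
  surv b I = sumOver (λ c → ⟦ not (kill b c I) ⟧) (choices b)

  weight : List Block → A → ℕ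
  weight Bs I = product (map (λ b → surv b I) Bs)

  sumOver-filterᵇ : ∀ (p : A → Bool) (f : A → ℕ) L →
    sumOver f (filterᵇ p L) ≡ sumOver (λ I → ⟦ p I ⟧ * f I) L
  sumOver-filterᵇ p f []      = refl
  sumOver-filterᵇ p f (I ∷ L) with p I
  ... | true  = cong₂ _+_ (sym (+-identityʳ (f I))) (sumOver-filterᵇ p f L)
  ... | false = sumOver-filterᵇ p f L

  ∈-filterᵇ : ∀ (p : A → Bool) {I} L → I L.∈ L → p I ≡ true → I L.∈ filterᵇ p L
  ∈-filterᵇ p (I ∷ L) (here refl) eq rewrite eq = here refl
  ∈-filterᵇ p (J ∷ L) (there q)   eq with p J
  ... | true  = there (∈-filterᵇ p L q eq)
  ... | false = ∈-filterᵇ p L q eq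

  sumOver-swap : ∀ (f : C → A → ℕ) cs L →
    sumOver (λ c → sumOver (f c) L) cs ≡ sumOver (λ I → sumOver (λ c → f c I) cs) L
  sumOver-swap f []       L = sym (trans (sumOver-const 0 L) (*-zeroʳ (length L)))
  sumOver-swap f (c ∷ cs) L =
    trans (cong (sumOver (f c) L +_) (sumOver-swap f cs L)) (sym (sumOver-+ (f c) _ L))

  pigeonhole : ∀ (f : C → ℕ) M cs → sumOver f cs < length cs * M → ∃ λ c → c L.∈ cs × f c < M
  pigeonhole f M (c ∷ cs) lt with f c <? M
  ... | yes p = c , here refl , p
  ... | no ¬p with pigeonhole f M cs (+-cancelˡ-< M _ _ (≤-<-trans (+-monoˡ-≤ _ (≮⇒≥ ¬p)) lt))
  ...   | c′ , q , r = c′ , there q , r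

  -- Averaging over the choices at `b` reproduces the total weight, so some choice leaves its
  -- survivors with weight below the product of the remaining block sizes. With no block left each
  -- survivor weighs 1 and the total is below 1, so there is none.
  greedy : ∀ Bs (L : List A) →
    sumOver (weight Bs) L < product (map (λ b → length (choices b)) Bs) →
    Σ (Fin (length Bs) → C) λ c → (∀ i → c i L.∈ choices (lookup Bs i)) ×
      (∀ I → I L.∈ L → ∃ λ i → kill (lookup Bs i) (c i) I ≡ true)
  greedy []       []      lt = (λ ()) , (λ ()) , λ _ ()
  greedy []       (I ∷ L) (s≤s ())
  greedy (b ∷ Bs) L       lt = c′ , c′∈ , kills
    where
    M = product (map (λ b → length (choices b)) Bs)

    average : sumOver (λ c → sumOver (weight Bs) (filterᵇ (λ I → not (kill b c I)) L)) (choices b)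
              ≡ sumOver (weight (b ∷ Bs)) L
    average = begin
      sumOver (λ c → sumOver (weight Bs) (filterᵇ (λ I → not (kill b c I)) L)) (choices b)
        ≡⟨ sumOver-cong (choices b) (λ c → sumOver-filterᵇ (λ I → not (kill b c I)) (weight Bs) L) ⟩
      sumOver (λ c → sumOver (λ I → ⟦ not (kill b c I) ⟧ * weight Bs I) L) (choices b)
        ≡⟨ sumOver-swap (λ c I → ⟦ not (kill b c I) ⟧ * weight Bs I) (choices b) L ⟩
      sumOver (λ I → sumOver (λ c → ⟦ not (kill b c I) ⟧ * weight Bs I) (choices b)) L
        ≡⟨ sumOver-cong L (λ I → trans (sumOver-cong (choices b) (λ c → *-comm _ (weight Bs I)))
             (trans (sumOver-*ˡ (weight Bs I) _ (choices b)) (*-comm (weight Bs I) _))) ⟩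
      sumOver (weight (b ∷ Bs)) L ∎
      where
      open ≡-Reasoning
      sumOver-cong : ∀ {X : Set} {f g : X → ℕ} xs → (∀ x → f x ≡ g x) → sumOver f xs ≡ sumOver g xs
      sumOver-cong []       h = refl
      sumOver-cong (x ∷ xs) h = cong₂ _+_ (h x) (sumOver-cong xs h)

    best = pigeonhole _ M (choices b) (subst (_< length (choices b) * M) (sym average) lt)
    c₀   = proj₁ best
    rest = greedy Bs (filterᵇ (λ I → not (kill b c₀ I)) L) (proj₂ (proj₂ best))

    c′ : Fin (suc (length Bs)) → C
    c′ zero    = c₀
    c′ (suc i) = proj₁ rest i

    c′∈ : ∀ i → c′ i L.∈ choices (lookup (b ∷ Bs) i)
    c′∈ zero    = proj₁ (proj₂ best)
    c′∈ (suc i) = proj₁ (proj₂ rest) i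

    kills : ∀ I → I L.∈ L → ∃ λ i → kill (lookup (b ∷ Bs) i) (c′ i) I ≡ true
    kills I q with kill b c₀ I in eq
    ... | true  = zero , eq
    ... | false with proj₂ (proj₂ rest) I (∈-filterᵇ _ L q (cong not eq))
    ...   | i , r = suc i , r

-- Survival probabilities and the union bound

-- This is `(1 + 1/u)^s ≥ 2` for `s > u`. The inner `bernoulli` keeps the first two terms of the
-- binomial expansion of `(u + 1)^(s + 1)`.
double-pow : ∀ u s → u < s → 2 * u ^ s ≤ suc u ^ s
double-pow zero    (suc s) _ = z≤n
double-pow u@(suc _) (suc s) (s≤s u≤s) = begin
  2 * (u * u ^ s)          ≡⟨ two (u * u ^ s) ⟩
  u * u ^ s + u * u ^ s    ≤⟨ +-monoʳ-≤ (u * u ^ s) (*-monoˡ-≤ (u ^ s) (≤-trans u≤s (n≤1+n s))) ⟩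
  u * u ^ s + suc s * u ^ s ≤⟨ bernoulli s ⟩
  suc u ^ suc s            ∎
  where
  open ≤-Reasoning
  two : ∀ a → 2 * a ≡ a + a
  two = solve-∀
  step : ∀ u s p → suc u * (u * p + suc s * p) ≡ u * (u * p) + suc (suc s) * (u * p) + suc s * p
  step = solve-∀
  bernoulli : ∀ s → u * u ^ s + suc s * u ^ s ≤ suc u ^ suc s
  bernoulli zero    = ≤-reflexive (base u)
    where
    base : ∀ u → u * 1 + 1 * 1 ≡ suc u * 1
    base = solve-∀
  bernoulli (suc s) = begin
    u * (u * u ^ s) + suc (suc s) * (u * u ^ s) ≤⟨ m≤m+n _ _ ⟩
    u * (u * u ^ s) + suc (suc s) * (u * u ^ s) + suc s * u ^ s ≡⟨ step u s (u ^ s) ⟨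
    suc u * (u * u ^ s + suc s * u ^ s) ≤⟨ *-monoʳ-≤ (suc u) (bernoulli s) ⟩
    suc u * suc u ^ suc s ∎

-- (1 - a/q)^s ≤ 2^(-a) for q = w + a ≤ s, with denominators cleared.
survival-bound : ∀ w a s → w + a ≤ s → w ^ s * 2 ^ a ≤ (w + a) ^ s
survival-bound w zero    s _  = ≤-reflexive (trans (*-identityʳ _) (cong (_^ s) (sym (+-identityʳ w))))
survival-bound w (suc a) s le = begin
  w ^ s * (2 * 2 ^ a)   ≡⟨ rearrange (w ^ s) (2 ^ a) ⟩
  2 * w ^ s * 2 ^ a     ≤⟨ *-monoˡ-≤ (2 ^ a) (double-pow w s
                            (≤-trans (≤-trans (s≤s (m≤m+n w a)) (≤-reflexive (sym (+-suc w a)))) le)) ⟩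
  suc w ^ s * 2 ^ a     ≤⟨ survival-bound (suc w) a s (≤-trans (≤-reflexive (sym (+-suc w a))) le) ⟩
  (suc w + a) ^ s       ≡⟨ cong (_^ s) (+-suc w a) ⟨
  (w + suc a) ^ s       ∎
  where
  open ≤-Reasoning
  rearrange : ∀ x y → x * (2 * y) ≡ 2 * x * y
  rearrange = solve-∀

^-distribʳ-* : ∀ a b s → (a * b) ^ s ≡ a ^ s * b ^ s
^-distribʳ-* a b zero    = refl
^-distribʳ-* a b (suc s) rewrite ^-distribʳ-* a b s = interchange a b (a ^ s) (b ^ s)
  where
  interchange : ∀ a b c d → a * b * (c * d) ≡ a * c * (b * d)
  interchange = solve-∀

-- Since `s` bounds every block size, the same exponent works for all factors and the powers of 2
-- multiply.
product-survival-bound : ∀ {Block : Set} (w a : Block → ℕ) s Bs → All (λ b → w b + a b ≤ s) Bs →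
  product (map w Bs) ^ s * 2 ^ sumOver a Bs ≤ product (map (λ b → w b + a b) Bs) ^ s
product-survival-bound w a s []       []       = ≤-reflexive (*-identityʳ _)
product-survival-bound w a s (b ∷ Bs) (p ∷ ps) = begin
  (w b * W) ^ s * 2 ^ (a b + sumOver a Bs)
    ≡⟨ cong₂ _*_ (^-distribʳ-* (w b) W s) (^-distribˡ-+-* 2 (a b) (sumOver a Bs)) ⟩
  w b ^ s * W ^ s * (2 ^ a b * 2 ^ sumOver a Bs)
    ≡⟨ interchange (w b ^ s) (W ^ s) (2 ^ a b) (2 ^ sumOver a Bs) ⟩
  w b ^ s * 2 ^ a b * (W ^ s * 2 ^ sumOver a Bs)
    ≤⟨ *-mono-≤ (survival-bound (w b) (a b) s p) (product-survival-bound w a s Bs ps) ⟩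
  (w b + a b) ^ s * product (map (λ b → w b + a b) Bs) ^ s
    ≡⟨ ^-distribʳ-* (w b + a b) _ s ⟨
  ((w b + a b) * product (map (λ b → w b + a b) Bs)) ^ s ∎
  where
  open ≤-Reasoning
  W = product (map w Bs)
  interchange : ∀ a b c d → a * b * (c * d) ≡ a * c * (b * d)
  interchange = solve-∀

-- The union bound: at most `N` terms, each below `Q / N`. The hypothesis `0 < Q` settles the empty
-- list.
sumOver-<-by-average : ∀ {A : Set} (f : A → ℕ) N Q L → length L ≤ N → 0 < Q →
  All (λ x → f x * N < Q) L → sumOver f L < Q
sumOver-<-by-average f N       (suc Q) []         len _ _   = s≤s z≤n
sumOver-<-by-average f N@(suc _) (suc Q) L@(_ ∷ _) len _ all = s≤s (*-cancelʳ-≤ _ _ N (begin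
  sumOver f L * N                ≡⟨ *-comm _ N ⟩
  N * sumOver f L                ≡⟨ sumOver-*ˡ N f L ⟨
  sumOver (λ x → N * f x) L      ≤⟨ sumOver-≤ (All.map (λ {x} p → ≤-trans (≤-reflexive (*-comm N (f x))) (s≤s⁻¹ p)) all) ⟩
  length L * Q                   ≤⟨ *-monoˡ-≤ Q len ⟩
  N * Q                          ≡⟨ *-comm N Q ⟩
  Q * N                          ∎))
  where open ≤-Reasoning

-- Moving `y` to the front and taking `j` further elements produces an edge through a prescribed
-- centre.
uniformSubset : ∀ {n} (l : List (Fin n)) → Unique l → ∀ {y} → y L.∈ l → ∀ j → suc j ≤ length l →
  ∃ λ (e : Subset n) → ∣ e ∣ ≡ suc j × y ∈ e × (∀ {x} → x ∈ e → x L.∈ l)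
uniformSubset l u {y} y∈ j le with ∈-∃++ y∈
... | xs , ys , refl = fromList l′ , size , []≔-∈ (fromList (take j (xs ++ ys))) y ,
    λ p → ∈-resp-↭ (↭-sym (shift y xs ys)) (incl (∈-fromList⁻ l′ p))
  where
  l′ = y ∷ take j (xs ++ ys)

  unique′ : Unique (y ∷ xs ++ ys)
  unique′ = Unique-resp-↭ (shift y xs ys) u

  j≤ : j ≤ length (xs ++ ys)
  j≤ = s≤s⁻¹ (≤-trans le (≤-reflexive
    (trans (length-++ xs) (trans (+-suc (length xs) (length ys)) (cong suc (sym (length-++ xs)))))))

  size : ∣ fromList l′ ∣ ≡ suc j
  size = trans (∣fromList∣ l′ (UniqueP.take⁺ (suc j) unique′))
    (cong suc (trans (length-take j (xs ++ ys)) (m≤n⇒m⊓n≡m j≤)))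

  incl : ∀ {x} → x L.∈ l′ → x L.∈ y ∷ xs ++ ys
  incl (here eq) = here eq
  incl (there q) = there (subst (_ L.∈_) (take++drop≡id j (xs ++ ys)) (∈-++⁺ˡ q))

-- Centres that meet every set of size t

count : ∀ {n} → Subset n → List (Fin n) → ℕ
count I = sumOver (λ x → ⟦ lookupᵥ I x ⟧)

length-filterᵇ : ∀ {A : Set} (p : A → Bool) l → length (filterᵇ p l) ≡ sumOver (λ x → ⟦ p x ⟧) l
length-filterᵇ p []      = refl
length-filterᵇ p (x ∷ l) with p x
... | true  = cong suc (length-filterᵇ p l)
... | false = length-filterᵇ p l

count-allFin : ∀ {n} (I : Subset n) → count I (allFin n) ≡ ∣ I ∣
count-allFin I = trans (cong sum (map-tabulate (λ i → i) (λ x → ⟦ lookupᵥ I x ⟧))) (sum-tabulate I)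
  where
  sum-tabulate : ∀ {n} (I : Subset n) → sum (tabulate (λ x → ⟦ lookupᵥ I x ⟧)) ≡ ∣ I ∣
  sum-tabulate []            = refl
  sum-tabulate (inside ∷ I)  = cong suc (sum-tabulate I)
  sum-tabulate (outside ∷ I) = sum-tabulate I

module Centres {K : Set} (r : ℕ) {m : ℕ} where

  -- With `x` as the centre, the block has an edge inside `I` exactly under this condition when `x`
  -- is one of its points.
  killed : K × List (Fin m) → Fin m → Subset m → Bool
  killed (_ , l) x I = lookupᵥ I x ∧ (r ≤ᵇ count I l)

  open Greedy {Block = K × List (Fin m)} proj₂ killed

  hits : Subset m → K × List (Fin m) → ℕ
  hits I (_ , l) = if r ≤ᵇ count I l then count I l else 0

  surv+hits : ∀ I b → surv b I + hits I b ≡ length (proj₂ b)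
  surv+hits I (_ , l) with r ≤ᵇ count I l
  ... | true  = split-count l
    where
    split-count : ∀ l → sumOver (λ x → ⟦ not (lookupᵥ I x ∧ true) ⟧) l + count I l ≡ length l
    split-count []      = refl
    split-count (x ∷ l) with lookupᵥ I x
    ... | true  = trans (+-suc _ _) (cong suc (split-count l))
    ... | false = cong suc (split-count l)
  ... | false = trans (+-identityʳ _) (all-survive l)
    where
    all-survive : ∀ l → sumOver (λ x → ⟦ not (lookupᵥ I x ∧ false) ⟧) l ≡ length l
    all-survive []      = refl
    all-survive (x ∷ l) with lookupᵥ I x
    ... | true  = cong suc (all-survive l)
    ... | false = cong suc (all-survive l)

  count≤hits+r : ∀ I b → count I (proj₂ b) ≤ hits I b + r
  count≤hits+r I (_ , l) with r ≤ᵇ count I l in eq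
  ... | true  = m≤m+n _ r
  ... | false = <⇒≤ (≰⇒> (λ le → subst T eq (≤⇒≤ᵇ le)))

  -- `few-blocks` says that at most half of the `δ * t` incidences of a `t`-set lie in blocks
  -- meeting it in too few points. `dense` makes the survival probability `2^(-δt/2s)` smaller than
  -- `2^(-ℓt)`, hence than `m^(-t)`.
  module _ (Bs : List (K × List (Fin m))) (s t δ ℓ : ℕ)
    (nonempty : All (λ b → 1 ≤ length (proj₂ b)) Bs)
    (short : All (λ b → length (proj₂ b) ≤ s) Bs)
    (m≤2^ℓ : m ≤ 2 ^ ℓ)
    (regular : ∀ I → sumOver (λ b → count I (proj₂ b)) Bs ≡ δ * ∣ I ∣)
    (few-blocks : 2 * (length Bs * r) ≤ δ * t)
    (dense : 2 * (ℓ * s) < δ) (0<t : 0 < t) where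

    open ≤-Reasoning

    private
      Q : ℕ
      Q = product (map (λ b → length (proj₂ b)) Bs)

      Q>0 : 0 < Q
      Q>0 = >-nonZero⁻¹ Q {{product≢0 (AllP.map⁺ (All.map >-nonZero nonempty))}}

      module _ (I : Subset m) (∣I∣≡t : ∣ I ∣ ≡ t) where

        H W : ℕ
        H = sumOver (hits I) Bs
        W = weight Bs I

        many-hits : δ * t ≤ 2 * H
        many-hits = +-cancelʳ-≤ (δ * t) (δ * t) (2 * H) (begin
          δ * t + δ * t                                   ≡⟨ double (δ * t) ⟩
          2 * (δ * t)                                     ≡⟨ cong (λ a → 2 * (δ * a)) ∣I∣≡t ⟨
          2 * (δ * ∣ I ∣)                                 ≡⟨ cong (2 *_) (regular I) ⟨
          2 * sumOver (λ b → count I (proj₂ b)) Bs        ≤⟨ *-monoʳ-≤ 2 (sumOver-mono Bs (count≤hits+r I)) ⟩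
          2 * sumOver (λ b → hits I b + r) Bs             ≡⟨ cong (2 *_) (trans
             (sumOver-+ (hits I) (λ _ → r) Bs) (cong (H +_) (sumOver-const r Bs))) ⟩
          2 * (H + length Bs * r)                         ≡⟨ *-distribˡ-+ 2 H _ ⟩
          2 * H + 2 * (length Bs * r)                     ≤⟨ +-monoʳ-≤ (2 * H) few-blocks ⟩
          2 * H + δ * t                                   ∎)
          where
          double : ∀ a → a + a ≡ 2 * a
          double = solve-∀

        weight-bound : W ^ s * 2 ^ H ≤ Q ^ s
        weight-bound = begin
          W ^ s * 2 ^ H
            ≤⟨ product-survival-bound (λ b → surv b I) (hits I) s Bs
                 (All.map (λ {b} p → ≤-trans (≤-reflexive (surv+hits I b)) p) short) ⟩
          product (map (λ b → surv b I + hits I b) Bs) ^ s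
            ≡⟨ cong (λ l → product l ^ s) (map-cong (surv+hits I) Bs) ⟩
          Q ^ s ∎

        -- The survival probability is `W / Q`. Were it at least `m^(-t)`, raising to the power `s`
        -- and cancelling `W ^ s` in `weight-bound` would give `H ≤ ℓ * t * s`, too few hits for
        -- `many-hits` and `dense`.
        light : W * m ^ t < Q
        light with W * m ^ t <? Q
        ... | yes p = p
        ... | no ¬p = contradiction (≤-<-trans contra lt) (<-irrefl refl)
          where
          Q≤ : Q ≤ W * m ^ t
          Q≤ = ≮⇒≥ ¬p

          instance
            W≢0 : NonZero W
            -- The cancellation is legitimate because `W * m ^ t` is at least `Q`, which is
            -- positive.
            W≢0 = m*n≢0⇒m≢0 W {m ^ t} {{>-nonZero (≤-trans Q>0 Q≤)}}

            W^s≢0 : NonZero (W ^ s)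
            W^s≢0 = m^n≢0 W s

          powers : 2 ^ H ≤ 2 ^ (ℓ * (t * s))
          powers = *-cancelˡ-≤ (W ^ s) (begin
            W ^ s * 2 ^ H              ≤⟨ weight-bound ⟩
            Q ^ s                      ≤⟨ ^-monoˡ-≤ s Q≤ ⟩
            (W * m ^ t) ^ s            ≡⟨ ^-distribʳ-* W (m ^ t) s ⟩
            W ^ s * (m ^ t) ^ s        ≡⟨ cong (W ^ s *_) (^-*-assoc m t s) ⟩
            W ^ s * m ^ (t * s)        ≤⟨ *-monoʳ-≤ (W ^ s) (^-monoˡ-≤ (t * s) m≤2^ℓ) ⟩
            W ^ s * (2 ^ ℓ) ^ (t * s)  ≡⟨ cong (W ^ s *_) (^-*-assoc 2 ℓ (t * s)) ⟩
            W ^ s * 2 ^ (ℓ * (t * s))  ∎)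

          few-hits : H ≤ ℓ * (t * s)
          few-hits = ≮⇒≥ (λ lt → ≤⇒≯ powers (^-monoʳ-< 2 (s≤s (s≤s z≤n)) lt))

          contra : δ * t ≤ 2 * (ℓ * s) * t
          contra = begin
            δ * t               ≤⟨ many-hits ⟩
            2 * H               ≤⟨ *-monoʳ-≤ 2 few-hits ⟩
            2 * (ℓ * (t * s))   ≡⟨ rearrange ℓ t s ⟩
            2 * (ℓ * s) * t     ∎
            where
            rearrange : ∀ ℓ t s → 2 * (ℓ * (t * s)) ≡ 2 * (ℓ * s) * t
            rearrange = solve-∀

          lt : 2 * (ℓ * s) * t < δ * t
          lt = *-monoˡ-< t {{>-nonZero 0<t}} dense

    centres : Σ (Fin (length Bs) → Fin m) λ c → (∀ i → c i L.∈ proj₂ (lookup Bs i)) ×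
      (∀ I → ∣ I ∣ ≡ t → ∃ λ i → c i ∈ I × r ≤ count I (proj₂ (lookup Bs i)))
    centres with greedy Bs (subsetsOfSize m t)
      (sumOver-<-by-average (weight Bs) (m ^ t) Q (subsetsOfSize m t) (length-subsetsOfSize m t) Q>0
        (All.map (λ {I} → light I) (subsetsOfSize-size m t)))
    ... | c , c∈ , kills = c , c∈ , λ I eq →
      killed⁻ I (kills I (subst (λ t → I L.∈ subsetsOfSize m t) eq (∈-subsetsOfSize I)))
      where
      killed⁻ : ∀ I → (∃ λ i → killed (lookup Bs i) (c i) I ≡ true) →
        ∃ λ i → c i ∈ I × r ≤ count I (proj₂ (lookup Bs i))
      killed⁻ I (i , eq) with lookupᵥ I (c i) in eq₁ | r ≤ᵇ count I (proj₂ (lookup Bs i)) in eq₂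
      ... | true | true = i , lookup⇒[]= (c i) I eq₁ , ≤ᵇ⇒≤ r _ (subst T (sym eq₂) _)

-- Incidences between points and lines

module _ {K : Set} {m : ℕ} (N : Fin m → List K) where

  -- The line comes first in each pair, being the key by which the points are grouped into blocks.
  incidences : List (K × Fin m)
  incidences = concatMap (λ i → map (_, i) (N i)) (allFin m)

  ∈-incidences⁻ : ∀ {v i} → (v , i) L.∈ incidences → v L.∈ N i
  ∈-incidences⁻ p with ∈-concat⁻′ (map (λ i → map (_, i) (N i)) (allFin m)) p
  ... | _ , q , q′ with ∈-map⁻ (λ i → map (_, i) (N i)) {xs = allFin m} q′
  ...   | j , _ , refl with ∈-map⁻ (_, j) q
  ...     | _ , q″ , refl = q″

  incidences-unique : (∀ i → Unique (N i)) → Unique incidences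
  incidences-unique u = UniqueP.concat⁺ {xss = map (λ i → map (_, i) (N i)) (allFin m)}
    (AllP.map⁺ (All.universal (λ i → UniqueP.map⁺ (cong proj₁) (u i)) (allFin m)))
    (AllPairsP.map⁺ (AllPairs.map disjoint (UniqueP.allFin⁺ m)))
    where
    disjoint : ∀ {i j} → i ≢ j → ∀ {e} → ¬ (e L.∈ map (_, i) (N i) × e L.∈ map (_, j) (N j))
    disjoint i≢j (p , q) with ∈-map⁻ _ p | ∈-map⁻ _ q
    ... | _ , _ , refl | _ , _ , refl = i≢j refl

  incidences-sum : ∀ δ → (∀ i → length (N i) ≡ δ) → ∀ (f : Fin m → ℕ) →
    sumOver (λ e → f (proj₂ e)) incidences ≡ δ * sumOver f (allFin m)
  incidences-sum δ regular f = go (allFin m)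
    where
    fibre : ∀ i (l : List K) → sumOver (λ e → f (proj₂ e)) (map (_, i) l) ≡ length l * f i
    fibre i []      = refl
    fibre i (_ ∷ l) = cong (f i +_) (fibre i l)

    go : ∀ xs → sumOver (λ e → f (proj₂ e)) (concatMap (λ i → map (_, i) (N i)) xs) ≡ δ * sumOver f xs
    go []       = sym (*-zeroʳ δ)
    go (i ∷ xs) = begin
      sumOver _ (map (_, i) (N i) ++ _) ≡⟨ sumOver-++ _ (map (_, i) (N i)) _ ⟩
      sumOver _ (map (_, i) (N i)) + _  ≡⟨ cong₂ _+_ (trans (fibre i (N i)) (cong (_* f i) (regular i))) (go xs) ⟩
      δ * f i + δ * sumOver f xs        ≡⟨ *-distribˡ-+ δ (f i) _ ⟨
      δ * (f i + sumOver f xs)          ∎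
      where open ≡-Reasoning

-- The r-graph

module _ (k′ : ℕ) where

  private k = suc k′

  toℕ-mod : ∀ {j} → j < k → toℕ (j mod k) ≡ j
  toℕ-mod {j} j<k = trans (Fin.toℕ-fromℕ< (m%n<n j k)) (m<n⇒m%n≡m j<k)

  -- Reduction modulo `k` lets a cyclic family be read as a sequence over ℕ whose entries at `k` and
  -- 0 agree.
  mod-cycSucc : ∀ {j} → j < k → CycSucc k (j mod k) (suc j mod k)
  mod-cycSucc {j} j<k with m≤n⇒m<n∨m≡n j<k
  ... | inj₁ lt   = inj₁ (trans (cong suc (toℕ-mod j<k)) (sym (toℕ-mod lt)))
  ... | inj₂ refl = inj₂ (cong suc (toℕ-mod j<k) , trans (Fin.toℕ-fromℕ< (m%n<n k k)) (n%n≡0 k))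

-- The factor 2 in `many-edges` pays for the incomplete stars, which are discarded. `balanced` is
-- the bound on the number of blocks, multiplied by the block size.
module Construction (k′ r′ m t δ′ s′ ℓ : ℕ) (G : Graph m) (girth : GirthMoreThan G (2 * suc k′))
  (many-edges : m * suc δ′ + m * suc δ′ ≤ numEdges G)
  (m≤2^ℓ : m ≤ 2 ^ ℓ)
  (balanced : 2 * suc r′ * (m * suc s′ + suc δ′ * m) ≤ suc δ′ * t * suc s′)
  (dense : 2 * (ℓ * suc s′) < suc δ′) (0<t : 0 < t) where

  private
    k = suc k′
    r = suc r′
    δ = suc δ′
    s = suc s′

  -- Unfolding `split` or `centres` during conversion checking is prohibitively expensive.
  abstract
    pointSplitting : Splitting δ (length (allFin m)) (edges G)
    pointSplitting = split Fin._≟_ δ′ (allFin m) (edges G) (All.universal (λ e → ∈-allFin (proj₁ e)) (edges G))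

  open Splitting pointSplitting using (rests; fulls; splits; full)

  -- Edges are stored once, smaller end first, and grouped by that end, so no edge belongs to two
  -- stars.
  points-unique : Unique (concatMap expand fulls)
  points-unique = unique-++ʳ (concatMap expand rests) (Unique-resp-↭ (↭-sym splits) (unique G))

  -- Incomplete stars use up at most `m * δ` edges, and the remaining `m * δ` or more fill at least
  -- `m` stars.
  enough-points : m ≤ length fulls
  enough-points = *-cancelʳ-≤ m (length fulls) δ (+-cancelˡ-≤ (m * δ) _ _ (begin
    m * δ + m * δ                              ≤⟨ many-edges ⟩
    numEdges G                                 ≤⟨ SplittingProperties.length-E≤ pointSplitting ⟩
    length (allFin m) * δ + length fulls * δ   ≡⟨ cong (λ n → n * δ + length fulls * δ) (length-tabulate {n = m} (λ i → i)) ⟩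
    m * δ + length fulls * δ                   ∎))
    where open ≤-Reasoning

  star : Fin m → Fin (length fulls)
  star x = inject≤ x enough-points

  π : Fin m → Fin m
  π x = proj₁ (lookup fulls (star x))

  lines : Fin m → List (Fin m)
  lines x = proj₂ (lookup fulls (star x))

  lines-length : ∀ x → length (lines x) ≡ δ
  lines-length x = All.lookup full (∈-lookup (star x))

  lines-adj : ∀ {x v} → v L.∈ lines x → Adj G (π x) v
  lines-adj {x} p = inj₁ (∈-resp-↭ splits (∈-++⁺ʳ (concatMap expand rests) (∈-block fulls (star x) p)))

  E′ : List (Fin m × Fin m)
  E′ = incidences lines

  E′-unique : Unique E′
  E′-unique = incidences-unique lines (λ x → expand-unique fulls points-unique (star x))

  length-E′ : length E′ ≡ δ * m
  length-E′ = begin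
    length E′                          ≡⟨ *-identityʳ (length E′) ⟨
    length E′ * 1                      ≡⟨ sumOver-const 1 E′ ⟨
    sumOver (λ _ → 1) E′               ≡⟨ incidences-sum lines δ lines-length (λ _ → 1) ⟩
    δ * sumOver (λ _ → 1) (allFin m)   ≡⟨ cong (δ *_) (trans (sumOver-const 1 (allFin m)) (*-identityʳ _)) ⟩
    δ * length (allFin m)              ≡⟨ cong (δ *_) (length-tabulate {n = m} (λ i → i)) ⟩
    δ * m                              ∎
    where open ≡-Reasoning

  abstract
    blockSplitting : Splitting s (length (allFin m)) E′
    blockSplitting = split Fin._≟_ s′ (allFin m) E′ (All.universal (λ e → ∈-allFin (proj₁ e)) E′)

  open SplittingProperties blockSplitting

  blocks-unique : Unique (concatMap expand blocks)
  blocks-unique = Unique-resp-↭ (↭-sym blocks-↭) E′-unique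

  Block : Set
  Block = Fin (length blocks)

  line : Block → Fin m
  line b = proj₁ (lookup blocks b)

  pointsOf : Block → List (Fin m)
  pointsOf b = proj₂ (lookup blocks b)

  line∈ : ∀ {x b} → x L.∈ pointsOf b → line b L.∈ lines x
  line∈ {b = b} p = ∈-incidences⁻ lines (∈-resp-↭ blocks-↭ (∈-block blocks b p))

  -- Two stars at the same vertex in a common block would both contain the edge from that vertex to
  -- the line of the block.
  π-injective : ∀ {x y b} → x L.∈ pointsOf b → y L.∈ pointsOf b → π x ≡ π y → x ≡ y
  π-injective {x} {y} p q eq = Fin.inject≤-injective enough-points enough-points x y
    (block-unique fulls points-unique (star x) (star y) eq (line∈ p) (line∈ q))

  few-blocks : 2 * (length blocks * r) ≤ δ * t
  few-blocks = *-cancelʳ-≤ _ _ s (begin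
    2 * (length blocks * r) * s                       ≡⟨ rearrange (length blocks) r s ⟩
    2 * r * (length blocks * s)                       ≤⟨ *-monoʳ-≤ (2 * r) length-blocks ⟩
    2 * r * (length (allFin m) * s + length E′)       ≡⟨ cong₂ (λ a b → 2 * r * (a * s + b)) (length-tabulate {n = m} (λ i → i)) length-E′ ⟩
    2 * r * (m * s + δ * m)                           ≤⟨ balanced ⟩
    δ * t * s                                         ∎)
    where
    open ≤-Reasoning
    rearrange : ∀ b r s → 2 * (b * r) * s ≡ 2 * r * (b * s)
    rearrange = solve-∀

  open Centres {K = Fin m} r {m}

  abstract
    chosen : Σ (Block → Fin m) λ c → (∀ i → c i L.∈ pointsOf i) ×
      (∀ I → ∣ I ∣ ≡ t → ∃ λ i → c i ∈ I × r ≤ count I (pointsOf i))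
    chosen = centres blocks s t δ ℓ blocks-nonempty blocks-short m≤2^ℓ
      (λ I → trans (blocks-sum (λ x → ⟦ lookupᵥ I x ⟧))
        (trans (incidences-sum lines δ lines-length (λ x → ⟦ lookupᵥ I x ⟧)) (cong (δ *_) (count-allFin I))))
      few-blocks dense 0<t

  centre : Block → Fin m
  centre = proj₁ chosen

  H : RGraph r m
  H = record
    { Edge = λ e → ∣ e ∣ ≡ r × ∃ λ b → centre b ∈ e × (∀ {x} → x ∈ e → x L.∈ pointsOf b)
    ; uniform = λ _ → proj₁ }

  -- Some block has its centre and at least `r` points in `I`; an `r`-subset of these through the
  -- centre is an edge.
  no-independent-set : ¬ IndependentSetOfSize H t
  no-independent-set (I , size , indep) with proj₂ (proj₂ chosen) I size
  ... | b , c∈I , r≤ with uniformSubset (filterᵇ (lookupᵥ I) (pointsOf b))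
      (UniqueP.filter⁺ (T? ∘ lookupᵥ I) (expand-unique blocks blocks-unique b))
      (∈-filter⁺ (T? ∘ lookupᵥ I) (proj₁ (proj₂ chosen) b) (Equivalence.from T-≡ ([]=⇒lookup c∈I)))
      r′ (≤-trans r≤ (≤-reflexive (sym (length-filterᵇ (lookupᵥ I) (pointsOf b)))))
  ...   | e , ∣e∣≡r , c∈e , e⊆ = indep e (∣e∣≡r , b , c∈e , λ p → proj₁ (inBoth p))
      (λ {x} p → lookup⇒[]= x I (Equivalence.to T-≡ (proj₂ (inBoth p))))
    where
    inBoth : ∀ {x} → x ∈ e → x L.∈ pointsOf b × T (lookupᵥ I x)
    inBoth p = ∈-filter⁻ (T? ∘ lookupᵥ I) (e⊆ p)

  -- The representatives are the transition points between consecutive blocks. All blocks therefore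
  -- coincide, and their centre lies in every edge, against non-triviality.
  no-berge-cycle : ¬ ContainsNontrivialBergeCycle H k
  no-berge-cycle (e , e∈H , _ , (v , v-inj , v∈) , nontrivial) =
    nontrivial (centre (block zero) , λ i → subst (λ b → centre b ∈ e i) (all-equal i) (centre∈ i))
    where
    block : Fin k → Block
    block i = proj₁ (proj₂ (e∈H i))

    centre∈ : ∀ i → centre (block i) ∈ e i
    centre∈ i = proj₁ (proj₂ (proj₂ (e∈H i)))

    e⊆block : ∀ i {x} → x ∈ e i → x L.∈ pointsOf (block i)
    e⊆block i = proj₂ (proj₂ (proj₂ (e∈H i)))

    P : ℕ → Block
    P j = block (j mod k)

    open BergeCycles G girth (λ x b → x L.∈ pointsOf b) π line
      (λ p → lines-adj (line∈ p)) π-injective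
      (λ {x} {b} {c} p q eq → block-unique blocks blocks-unique b c eq p q)
      k ≤-refl P (λ j → v (j mod k))
      (λ j j<k → e⊆block _ (proj₁ (v∈ _ _ (mod-cycSucc k′ j<k))))
      (λ j j<k → e⊆block _ (proj₂ (v∈ _ _ (mod-cycSucc k′ j<k))))
      (λ i j i<j j<k eq → <⇒≢ i<j
        (trans (sym (toℕ-mod k′ (<-trans i<j j<k))) (trans (cong toℕ (v-inj eq)) (toℕ-mod k′ j<k))))

    wrap : k mod k ≡ zero
    wrap = Fin.toℕ-injective (trans (Fin.toℕ-fromℕ< (m%n<n k k)) (n%n≡0 k))

    all-equal : ∀ i → block i ≡ block zero
    all-equal i = trans (cong block (sym (Fin.toℕ-injective (toℕ-mod k′ (Fin.toℕ<n i)))))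
      (blocks-equal (cong block wrap) (toℕ i) (<⇒≤ (Fin.toℕ<n i)))

  not-ramsey : ¬ RamseyProperty r k t m
  not-ramsey ramsey = [ no-berge-cycle , no-independent-set ]′ (ramsey H)

-- Choice of the parameters

construction : ∀ k r m t δ s ℓ → 1 ≤ k → 1 ≤ r → 1 ≤ δ → 1 ≤ s → (G : Graph m) → GirthMoreThan G (2 * k) →
  m * δ + m * δ ≤ numEdges G → m ≤ 2 ^ ℓ → 2 * r * (m * s + δ * m) ≤ δ * t * s →
  2 * (ℓ * s) < δ → 0 < t → ¬ RamseyProperty r k t m
construction (suc k′) (suc r′) m t (suc δ′) (suc s′) ℓ _ _ _ _ G girth a b c d e =
  Construction.not-ramsey k′ r′ m t δ′ s′ ℓ G girth a b c d e

-- Apply the property to the edgeless `r`-graph. This makes `m` large enough for the dense graphs to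
-- exist.
ramsey⇒t≤m : ∀ r k t m → RamseyProperty r (suc k) t m → t ≤ m
ramsey⇒t≤m r k t m ramsey with ramsey (record { Edge = λ _ → ⊥ ; uniform = λ _ () })
... | inj₁ (_ , edge , _)   = contradiction (edge zero) (λ ())
... | inj₂ (I , ∣I∣≡t , _) = ≤-trans (≤-reflexive (sym ∣I∣≡t)) (∣p∣≤n I)

^-cancelˡ-< : ∀ k a b → a ^ k < b ^ k → a < b
^-cancelˡ-< k a b lt = ≰⇒> (λ le → ≤⇒≯ (^-monoˡ-≤ k le) lt)

n<2^[1+⌊log₂n⌋] : ∀ n → n < 2 ^ suc ⌊log₂ n ⌋
n<2^[1+⌊log₂n⌋] n = ≰⇒> (λ le → 1+n≰n (≤-trans (≤-reflexive (sym (⌊log₂[2^n]⌋≡n _))) (⌊log₂⌋-mono-≤ le)))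

m<[1+m/n]*n : ∀ m n .{{_ : NonZero n}} → m < suc (m / n) * n
m<[1+m/n]*n m n = ≤-<-trans (≤-reflexive (m≡m%n+[m/n]*n m n)) (+-monoˡ-< (m / n * n) (m%n<n m n))

n≤n^1+k : ∀ n k .{{_ : NonZero n}} → n ≤ n ^ suc k
n≤n^1+k n k = ≤-trans (≤-reflexive (sym (^-identityʳ n))) (^-monoʳ-≤ n {1} {suc k} (s≤s z≤n))

-- The hypothesis is `c * e ≥ m^(1 + 1/k)` freed of roots. With `q = 2` it forces `e ≥ 2m` for large
-- `m`; with `q = 4δ` it bounds `m` by a multiple of `δ^k`.
density-bound : ∀ k c q m e .{{_ : NonZero m}} → m ^ (k + 1) ≤ (c * e) ^ k → e ≤ q * m → m ≤ (c * q) ^ k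
density-bound k c q m e dense e≤ = *-cancelʳ-≤ m ((c * q) ^ k) (m ^ k) {{m^n≢0 m k}} (begin
  m * m ^ k               ≡⟨ cong (m ^_) (+-comm k 1) ⟨
  m ^ (k + 1)             ≤⟨ dense ⟩
  (c * e) ^ k             ≤⟨ ^-monoˡ-≤ k (*-monoʳ-≤ c e≤) ⟩
  (c * (q * m)) ^ k       ≡⟨ cong (_^ k) (*-assoc c q m) ⟨
  (c * q * m) ^ k         ≡⟨ ^-distribʳ-* (c * q) m k ⟩
  (c * q) ^ k * m ^ k     ∎)
  where open ≤-Reasoning

module Parameters (k″ r d : ℕ) (1≤r : 1 ≤ r) where

  -- `suc d` stands for `1/c`; the 4 in `d₁` comes from `e ≤ 4δm`. `K` collects the factors of
  -- `2 * ℓ * s * t ≤ K * m * λ₂`, and `D` is what remains after taking `k`-th powers.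
  k k′ d₁ K C D : ℕ
  k′ = suc k″
  k  = suc k′
  d₁ = suc d * 4
  K  = 32 * r * k
  C  = K * d₁
  D  = C ^ k

  module _ (t m λ₂ : ℕ) (2≤t : 2 ≤ t) (t≤m : t ≤ m) (1≤λ : 1 ≤ λ₂) (t<2^1+λ : t < 2 ^ suc λ₂)
    (small : (suc D * m) ^ k′ * λ₂ ^ k < t ^ k) (t-large : (suc d * 2) ^ k < t)
    (G : Graph m) (girth : GirthMoreThan G (2 * k)) (edges-many : m ^ (k + 1) ≤ (suc d * numEdges G) ^ k) where

    open ≤-Reasoning

    e ℓ : ℕ
    e = numEdges G
    ℓ = 2 * λ₂ * k

    instance
      t≢0 : NonZero t
      t≢0 = >-nonZero (≤-trans (s≤s z≤n) 2≤t)

      m≢0 : NonZero m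
      m≢0 = >-nonZero (≤-trans (≤-trans (s≤s z≤n) 2≤t) t≤m)

      2m≢0 : NonZero (2 * m)
      2m≢0 = m*n≢0 2 m

      λ≢0 : NonZero λ₂
      λ≢0 = >-nonZero 1≤λ

      r≢0 : NonZero r
      r≢0 = >-nonZero 1≤r

    2m≤e : 2 * m ≤ e
    2m≤e = ≮⇒≥ (λ lt → ≤⇒≯ (density-bound k (suc d) 2 m e edges-many (<⇒≤ lt)) (<-≤-trans t-large t≤m))

    -- Half the edge density, rounded down, and a block size for which a `t`-set meets a block of a
    -- typical line often enough: `s * t` is between `4rm` and `8rm`.
    δ s : ℕ
    δ = e / (2 * m)
    s = (8 * r * m) / t

    1≤δ : 1 ≤ δ
    1≤δ = m≥n⇒m/n>0 2m≤e

    m≤4rm : m ≤ 4 * r * m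
    m≤4rm = m≤n*m m (4 * r) {{m*n≢0 4 r}}

    1≤s : 1 ≤ s
    1≤s = m≥n⇒m/n>0 (≤-trans t≤m (m≤n*m m (8 * r) {{m*n≢0 8 r}}))

    many : m * δ + m * δ ≤ e
    many = begin
      m * δ + m * δ     ≡⟨ rearrange m δ ⟩
      δ * (2 * m)       ≤⟨ m/n*n≤m e (2 * m) ⟩
      e                 ∎
      where
      rearrange : ∀ m δ → m * δ + m * δ ≡ δ * (2 * m)
      rearrange = solve-∀

    e≤4δm : e ≤ (4 * δ) * m
    e≤4δm = begin
      e                       ≤⟨ <⇒≤ (m<[1+m/n]*n e (2 * m)) ⟩
      suc δ * (2 * m)         ≤⟨ *-monoˡ-≤ (2 * m) (+-monoˡ-≤ δ 1≤δ) ⟩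
      (δ + δ) * (2 * m)       ≡⟨ rearrange m δ ⟩
      (4 * δ) * m             ∎
      where
      rearrange : ∀ m δ → (δ + δ) * (2 * m) ≡ 4 * δ * m
      rearrange = solve-∀

    m≤[d₁δ]^k : m ≤ (d₁ * δ) ^ k
    m≤[d₁δ]^k = ≤-trans (density-bound k (suc d) (4 * δ) m e edges-many e≤4δm)
      (≤-reflexive (cong (_^ k) (sym (*-assoc (suc d) 4 δ))))

    -- A polynomial bound on `m`, so that `log m` is at most a constant times `log t`; it rests on
    -- `k ≥ 2`.
    m≤t^k : m ≤ t ^ k
    m≤t^k = begin
      m                              ≤⟨ n≤n^1+k m k″ ⟩
      m ^ k′                         ≤⟨ ^-monoˡ-≤ k′ (m≤n*m m (suc D)) ⟩
      (suc D * m) ^ k′               ≤⟨ m≤m*n _ (λ₂ ^ k) {{m^n≢0 λ₂ k}} ⟩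
      (suc D * m) ^ k′ * λ₂ ^ k      ≤⟨ <⇒≤ small ⟩
      t ^ k                          ∎

    m≤2^ℓ : m ≤ 2 ^ ℓ
    m≤2^ℓ = begin
      m                    ≤⟨ m≤t^k ⟩
      t ^ k                ≤⟨ ^-monoˡ-≤ k (≤-trans (<⇒≤ t<2^1+λ) (^-monoʳ-≤ 2 1+λ≤2λ)) ⟩
      (2 ^ (2 * λ₂)) ^ k   ≡⟨ ^-*-assoc 2 (2 * λ₂) k ⟩
      2 ^ ℓ                ∎
      where
      1+λ≤2λ : suc λ₂ ≤ 2 * λ₂
      1+λ≤2λ = ≤-trans (+-monoˡ-≤ λ₂ 1≤λ) (≤-reflexive (cong (λ₂ +_) (sym (+-identityʳ λ₂))))

    -- The central inequality: multiply `small` by `m`, replace `m` on the right by `(d₁ * δ) ^ k`,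
    -- and take `k`-th roots. The conditions `balanced` and `dense` both follow from it.
    Kmλ<tδ : K * m * λ₂ < δ * t
    Kmλ<tδ = *-cancelˡ-< d₁ _ _ (^-cancelˡ-< k _ _ (begin-strict
      (d₁ * (K * m * λ₂)) ^ k
        ≡⟨ cong (_^ k) (rearrange d₁ K m λ₂) ⟩
      (C * (m * λ₂)) ^ k
        ≡⟨ trans (^-distribʳ-* C (m * λ₂) k) (cong (C ^ k *_) (^-distribʳ-* m λ₂ k)) ⟩
      D * (m * m ^ k′ * λ₂ ^ k)
        -- As `k′ ≥ 1`, the constant may be raised to the power `k′` that it carries in `small`.
        ≤⟨ *-monoˡ-≤ _ (≤-trans (n≤1+n D) (n≤n^1+k (suc D) k″)) ⟩
      suc D ^ k′ * (m * m ^ k′ * λ₂ ^ k)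
        ≡⟨ rearrange′ (suc D ^ k′) m (m ^ k′) (λ₂ ^ k) ⟩
      suc D ^ k′ * m ^ k′ * λ₂ ^ k * m
        ≡⟨ cong (λ a → a * λ₂ ^ k * m) (^-distribʳ-* (suc D) m k′) ⟨
      (suc D * m) ^ k′ * λ₂ ^ k * m
        <⟨ *-monoˡ-< m small ⟩
      t ^ k * m
        ≤⟨ *-monoʳ-≤ (t ^ k) m≤[d₁δ]^k ⟩
      t ^ k * (d₁ * δ) ^ k
        ≡⟨ ^-distribʳ-* t (d₁ * δ) k ⟨
      (t * (d₁ * δ)) ^ k
        ≡⟨ cong (_^ k) (rearrange″ t d₁ δ) ⟩
      (d₁ * (δ * t)) ^ k ∎))
      where
      rearrange : ∀ d K m l → d * (K * m * l) ≡ K * d * (m * l)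
      rearrange = solve-∀
      rearrange′ : ∀ a m b c → a * (m * b * c) ≡ a * b * c * m
      rearrange′ = solve-∀
      rearrange″ : ∀ t d δ → t * (d * δ) ≡ d * (δ * t)
      rearrange″ = solve-∀

    st≤8rm : s * t ≤ 8 * r * m
    st≤8rm = m/n*n≤m (8 * r * m) t

    -- Rounding `s` down loses less than `t` from `8rm`, and `t ≤ m ≤ 4rm`.
    4rm≤st : 4 * r * m ≤ s * t
    4rm≤st = +-cancelʳ-≤ (4 * r * m) _ _ (begin
      4 * r * m + 4 * r * m   ≡⟨ rearrange r m ⟩
      8 * r * m               ≤⟨ <⇒≤ (m<[1+m/n]*n (8 * r * m) t) ⟩
      t + s * t               ≤⟨ +-monoˡ-≤ (s * t) (≤-trans t≤m m≤4rm) ⟩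
      4 * r * m + s * t       ≡⟨ +-comm _ (s * t) ⟩
      s * t + 4 * r * m       ∎)
      where
      rearrange : ∀ r m → 4 * r * m + 4 * r * m ≡ 8 * r * m
      rearrange = solve-∀

    4rm≤δt : 4 * r * m ≤ δ * t
    4rm≤δt = begin
      4 * r * m                   ≤⟨ m≤n*m (4 * r * m) (8 * k * λ₂) {{m*n≢0 (8 * k) λ₂}} ⟩
      8 * k * λ₂ * (4 * r * m)    ≡⟨ rearrange k λ₂ r m ⟩
      K * m * λ₂                  ≤⟨ <⇒≤ Kmλ<tδ ⟩
      δ * t                       ∎
      where
      rearrange : ∀ k l r m → 8 * k * l * (4 * r * m) ≡ 32 * r * k * m * l
      rearrange = solve-∀

    balanced : 2 * r * (m * s + δ * m) ≤ δ * t * s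
    -- After doubling, the two summands are bounded separately, by `4rm ≤ δt` and `4rm ≤ st`.
    balanced = *-cancelˡ-≤ 2 (begin
      2 * (2 * r * (m * s + δ * m))             ≡⟨ rearrange r m s δ ⟩
      (4 * r * m) * s + δ * (4 * r * m)         ≤⟨ +-mono-≤ (*-monoˡ-≤ s 4rm≤δt) (*-monoʳ-≤ δ 4rm≤st) ⟩
      δ * t * s + δ * (s * t)                   ≡⟨ rearrange′ δ t s ⟩
      2 * (δ * t * s)                           ∎)
      where
      rearrange : ∀ r m s δ → 2 * (2 * r * (m * s + δ * m)) ≡ 4 * r * m * s + δ * (4 * r * m)
      rearrange = solve-∀
      rearrange′ : ∀ δ t s → δ * t * s + δ * (s * t) ≡ 2 * (δ * t * s)
      rearrange′ = solve-∀

    dense : 2 * (ℓ * s) < δ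
    dense = *-cancelʳ-< t _ _ (begin-strict
      2 * (ℓ * s) * t                ≡⟨ rearrange λ₂ k s t ⟩
      4 * λ₂ * k * (s * t)           ≤⟨ *-monoʳ-≤ (4 * λ₂ * k) st≤8rm ⟩
      4 * λ₂ * k * (8 * r * m)       ≡⟨ rearrange′ λ₂ k r m ⟩
      K * m * λ₂                     <⟨ Kmλ<tδ ⟩
      δ * t                          ∎)
      where
      rearrange : ∀ l k s t → 2 * (2 * l * k * s) * t ≡ 4 * l * k * (s * t)
      rearrange = solve-∀
      rearrange′ : ∀ l k r m → 4 * l * k * (8 * r * m) ≡ 32 * r * k * m * l
      rearrange′ = solve-∀

    not-ramsey : ¬ RamseyProperty r k t m
    not-ramsey = construction k r m t δ s ℓ (s≤s z≤n) 1≤r 1≤δ 1≤s G girth many m≤2^ℓ balanced dense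
      (≤-trans (s≤s z≤n) 2≤t)

-- The conclusion is `m ≥ c (t / log t)^(k/(k-1))` freed of roots and denominators, for every `m`
-- with the Ramsey property and so for the least. Using the rounded binary logarithm affects only
-- the constant.
theorem2 : (k r : ℕ) → 2 ≤ k → 3 ≤ r →
    (Σ ℕ λ d → Σ ℕ λ N₀ → ∀ n → N₀ ≤ n →
    Σ (Graph n) λ G → GirthMoreThan G (2 * k) × (n ^ (k + 1) ≤ (suc d * numEdges G) ^ k)) →
    Σ ℕ λ D → Σ ℕ λ T₀ → ∀ t → T₀ ≤ t → ∀ m → RamseyProperty r k t m →
    t ^ k ≤ (suc D * m) ^ (k ∸ 1) * ⌊log₂ t ⌋ ^ k
theorem2 k@(suc (suc k″)) r (s≤s (s≤s z≤n)) 3≤r (d , N₀ , dense-graphs) = P.D , T₀ , bound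
  where
  module P = Parameters k″ r d (≤-trans (s≤s z≤n) 3≤r)

  -- `N₀` gives the dense graph on `m ≥ t` vertices, 2 makes the logarithm positive, and the power
  -- ensures `e ≥ 2m`.
  T₀ = N₀ + (2 + (suc d * 2) ^ k)

  bound : ∀ t → T₀ ≤ t → ∀ m → RamseyProperty r k t m →
    t ^ k ≤ (suc P.D * m) ^ (k ∸ 1) * ⌊log₂ t ⌋ ^ k
  bound t T₀≤t m ramsey = ≮⇒≥ (λ small →
    P.not-ramsey t m ⌊log₂ t ⌋ 2≤t t≤m 1≤log (n<2^[1+⌊log₂n⌋] t) small large
      (proj₁ G) (proj₁ (proj₂ G)) (proj₂ (proj₂ G)) ramsey)
    where
    t≤m = ramsey⇒t≤m r _ t m ramsey
    G = dense-graphs m (≤-trans (≤-trans (m≤m+n N₀ _) T₀≤t) t≤m)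

    2+≤t : 2 + (suc d * 2) ^ k ≤ t
    2+≤t = ≤-trans (m≤n+m _ N₀) T₀≤t

    2≤t : 2 ≤ t
    2≤t = ≤-trans (m≤m+n 2 _) 2+≤t

    large : (suc d * 2) ^ k < t
    large = ≤-trans (n≤1+n _) 2+≤t

    1≤log : 1 ≤ ⌊log₂ t ⌋
    1≤log = ≤-trans (≤-reflexive (sym (⌊log₂[2^n]⌋≡n 1))) (⌊log₂⌋-mono-≤ 2≤t)
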